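{- Let $r\in\mathbb{N}$ and let $G$ be a graph with at least one edge such that $\Delta(G)-1\le r$. (i) If $r\le 7$ and $k\ge r+1$, then $G$ is equitably $k$-list arborable. (ii) If $k\ge r+1+\frac{r-1}{7}$ when $r\le 30$, or $k\ge r+\frac{r}{6}$ when $r\ge 31$, then $G$ is equitably $k$-list arborable. (iii) If $|V(G)|\ge r^3$ and $k\ge r+2$, then $G$ is equitably $k$-list arborable. (iv) If $\omega(G)\le r$ and $|V(G)|\ge 3(r+1)r^8$, then $G$ is equitably $(r+1)$-list arborable.
   Context: All graphs are finite, simple and undirected; $\Delta(G)$ is the maximum degree and $\omega(G)$ the clique number. A $k$-uniform list assignment $L$ for $G$ assigns to each vertex $v$ a set $L(v)$ of exactly $k$ colours (positive integers); an $L$-colouring is a map $c$ with $c(v)\in L(v)$ for all $v$. An $L$-colouring is equitable if every colour class has at most $\lceil |V(G)|/k\rceil$ vertices. $G$ is equitably $k$-list arborable if for every $k$-uniform list assignment $L$ there is an equitable $L$-colouring of $G$ in which every colour class induces an acyclic subgraph of $G$. -}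

module Defs where

open import Data.Nat using (ℕ; zero; suc; _+_; _∸_; _≤_; _⊔_)
open import Data.Nat.DivMod using (_/_)
open import Data.Bool using (Bool; true; false)
open import Data.Fin using (Fin; zero; suc; inject₁; fromℕ)
open import Data.List using (List; length; filter; filterᵇ; map; foldr; allFin)
open import Data.List.Membership.Propositional using (_∈_)
open import Data.List.Relation.Unary.Unique.Propositional using (Unique)
open import Data.Product using (Σ; ∃; _×_; _,_)
open import Data.Fin.Subset using (Subset; _∈_)
open import Function.Definitions using (Injective)
open import Relation.Binary.PropositionalEquality using (_≡_)
open import Relation.Nullary using (¬_)

record Graph : Set where
  field
    n      : ℕ
    adj    : Fin n → Fin n → Bool
    sym    : ∀ u v → adj u v ≡ adj v u
    irrefl : ∀ v → adj v v ≡ false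

open Graph public

∣V∣ : Graph → ℕ
∣V∣ G = n G

HasEdge : Graph → Set
HasEdge G = Σ (Fin (n G)) λ u → Σ (Fin (n G)) λ v → adj G u v ≡ true

degree : (G : Graph) → Fin (n G) → ℕ
degree G v = length (filterᵇ (adj G v) (allFin (n G)))

Δ : Graph → ℕ
Δ G = foldr _⊔_ 0 (map (degree G) (allFin (n G)))

IsClique : (G : Graph) → List (Fin (n G)) → Set
IsClique G S = Unique S × (∀ u v → u Data.List.Membership.Propositional.∈ S → v Data.List.Membership.Propositional.∈ S → ¬ (u ≡ v) → adj G u v ≡ true)

ω≤ : Graph → ℕ → Set
ω≤ G r = ∀ S → IsClique G S → length S ≤ r

record CycleIn (G : Graph) (P : Fin (n G) → Set) : Set where
  field
    m     : ℕ
    cyc   : Fin (3 + m) → Fin (n G)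
    inj   : Injective _≡_ _≡_ cyc
    step  : ∀ (i : Fin (2 + m)) → adj G (cyc (inject₁ i)) (cyc (suc i)) ≡ true
    close : adj G (cyc (fromℕ (2 + m))) (cyc zero) ≡ true
    inP   : ∀ i → P (cyc i)

InducesAcyclic : (G : Graph) → (Fin (n G) → Set) → Set
InducesAcyclic G P = ¬ CycleIn G P

record ListAssignment (G : Graph) (k : ℕ) : Set where
  field
    L        : Fin (n G) → List ℕ
    distinct : ∀ v → Unique (L v)
    size     : ∀ v → length (L v) ≡ k

open ListAssignment public

IsLColouring : (G : Graph) {k : ℕ} → ListAssignment G k → (Fin (n G) → ℕ) → Set
IsLColouring G La c = ∀ v → c v Data.List.Membership.Propositional.∈ L La v

-- ⌈ a / k ⌉ (k = 0 case is irrelevant; set to a)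
⌈_/_⌉ : ℕ → ℕ → ℕ
⌈ a / zero ⌉ = a
⌈ a / suc k ⌉ = (a + k) / suc k

colourClassSize : (G : Graph) → (Fin (n G) → ℕ) → ℕ → ℕ
colourClassSize G c i = length (filter (λ v → c v Data.Nat.≟ i) (allFin (n G)))

IsEquitable : (G : Graph) → ℕ → (Fin (n G) → ℕ) → Set
IsEquitable G k c = ∀ i → colourClassSize G c i ≤ ⌈ n G / k ⌉

EquitablyListArborable : Graph → ℕ → Set
EquitablyListArborable G k =
  (La : ListAssignment G k) →
  Σ (Fin (n G) → ℕ) λ c →
    IsLColouring G La c × IsEquitable G k c × (∀ i → InducesAcyclic G (λ v → c v ≡ i))

-- All four parts hold because Δ(G) ≤ k already suffices. Put m = ⌈n/k⌉ and colour the vertices one at a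
-- time, keeping classes acyclic and of size at most m. A vertex may move into a class containing at most
-- one of its neighbours. Starting from the uncoloured vertices, follow such moves to reach colours; if some
-- reached class has room, shifting vertices along the chain of moves colours one more vertex. Otherwise
-- the reached set A of s colours consists of full classes. Let S be the set of vertices that are uncoloured
-- or coloured from A: then |S| > sm, so s < k and fewer than (k - s)m vertices lie outside S. Each vertex of
-- S has at least two neighbours in each of at least k - s classes outside A, hence at least 2(k - s)
-- neighbours outside S. Comparing with the degree of one vertex of S gives 2(k - s) ≤ Δ ≤ k, so Δ ≤ 2s,
-- while counting the edges leaving S gives 2(k - s)sm < Δ(k - s)m, that is 2s < Δ.

module Submission where

open import Defs renaming (sym to adj-sym)
open import Data.Nat using (ℕ; _+_; _*_; _∸_; _^_; _≤_)
open import Data.Product using (_×_)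
open import Data.Bool using (Bool; true; false)
open import Data.Empty using (⊥)
open import Data.Fin using (Fin; zero; suc; inject₁; fromℕ; toℕ)
import Data.Fin.Properties as Fin
open import Data.Fin.Relation.Unary.Top using (view; ‵fromℕ; ‵inject₁)
open import Data.List using (List; []; _∷_; length; map; foldr; filter; filterᵇ; allFin)
open import Data.List.Membership.Propositional using (_∈_; _∉_; find; lose)
open import Data.List.Membership.Propositional.Properties using (∈-allFin; ∈-map⁻; ∈-map⁺)
import Data.List.Membership.DecPropositional as DecMembership
open import Data.List.Properties using (length-tabulate)
open import Data.List.Relation.Unary.All as All using (All; []; _∷_)
open import Data.List.Relation.Unary.All.Properties using (¬Any⇒All¬)
open import Data.List.Relation.Unary.AllPairs using ([]; _∷_)
open import Data.List.Relation.Unary.Any as Any using (here; there)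
open import Data.List.Relation.Unary.Unique.Propositional using (Unique)
open import Data.List.Relation.Unary.Unique.Propositional.Properties using (map⁺; allFin⁺)
open import Data.Maybe using (Maybe; just; nothing; fromMaybe)
open import Data.Maybe.Properties using (just-injective; ≡-dec)
open import Data.Nat using (zero; suc; _<_; _⊔_; z≤n; s≤s; s≤s⁻¹; _≟_; _≤?_)
open import Data.Nat.DivMod using (_/_; _%_; m≡m%n+[m/n]*n; m%n<n)
open import Data.Nat.Properties hiding (_≟_; _≤?_)
open import Data.Nat.ListAction using (sum)
open import Data.Nat.Solver using (module +-*-Solver)
open import Data.Product using (∃; ∃₂; _,_; proj₂)
open import Data.Vec.Functional using (updateAt)
open import Data.Vec.Functional.Properties using (updateAt-updates; updateAt-minimal)
open import Function using (_∘_; const)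
open import Relation.Binary.PropositionalEquality
  using (_≡_; _≢_; refl; sym; trans; cong; cong₂; subst; ≢-sym)
open import Relation.Nullary using (¬_; Dec; yes; no; does; ¬?; contradiction)
open import Relation.Nullary.Decidable using (_×-dec_)

private variable
  A B P Q : Set

-- Indicators of decidable propositions

⟦_⟧ : Bool → ℕ
⟦ true ⟧  = 1
⟦ false ⟧ = 0

𝟙 : Dec P → ℕ
𝟙 P? = ⟦ does P? ⟧

𝟙-mono : (P? : Dec P) (Q? : Dec Q) → (P → Q) → 𝟙 P? ≤ 𝟙 Q?
𝟙-mono (no _)  _       _   = z≤n
𝟙-mono (yes _) (yes _) _   = ≤-refl
𝟙-mono (yes p) (no ¬q) P⇒Q = contradiction (P⇒Q p) ¬q

𝟙-true : (P? : Dec P) → P → 𝟙 P? ≡ 1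
𝟙-true (yes _) _ = refl
𝟙-true (no ¬p) p = contradiction p ¬p

𝟙-false : (P? : Dec P) → ¬ P → 𝟙 P? ≡ 0
𝟙-false (yes p) ¬p = contradiction p ¬p
𝟙-false (no _)  _  = refl

𝟙-complement : (P? : Dec P) → 𝟙 P? + 𝟙 (¬? P?) ≡ 1
𝟙-complement (yes _) = refl
𝟙-complement (no _)  = refl

m*𝟙≤m : ∀ m (P? : Dec P) → m * 𝟙 P? ≤ m
m*𝟙≤m m (yes _) = ≤-reflexive (*-identityʳ m)
m*𝟙≤m m (no _)  = ≤-trans (≤-reflexive (*-zeroʳ m)) z≤n

-- Only `b` is weighted: when `P` fails the left side vanishes and `c` is harmless, so in the edge
-- count `c` may be summed over all vertices.
𝟙*-≤ : (P? : Dec P) {a b c : ℕ} → (P → a ≤ b + c) → 𝟙 P? * a ≤ 𝟙 P? * b + c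
𝟙*-≤ (no _)  _ = z≤n
𝟙*-≤ (yes p) {a} {b} {c} P⇒≤ = begin
  1 * a        ≡⟨ *-identityˡ a ⟩
  a            ≤⟨ P⇒≤ p ⟩
  b + c        ≡⟨ cong (_+ c) (*-identityˡ b) ⟨
  1 * b + c    ∎
  where open ≤-Reasoning

-- Finite sums

∑ : List A → (A → ℕ) → ℕ
∑ xs f = sum (map f xs)

∑-mono : (xs : List A) {f g : A → ℕ} → (∀ x → x ∈ xs → f x ≤ g x) → ∑ xs f ≤ ∑ xs g
∑-mono []       _   = z≤n
∑-mono (x ∷ xs) f≤g = +-mono-≤ (f≤g x (here refl)) (∑-mono xs (λ y → f≤g y ∘ there))

∑-cong : (xs : List A) {f g : A → ℕ} → (∀ x → f x ≡ g x) → ∑ xs f ≡ ∑ xs g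
∑-cong []       _   = refl
∑-cong (x ∷ xs) f≡g = cong₂ _+_ (f≡g x) (∑-cong xs f≡g)

∑-+ : (xs : List A) (f g : A → ℕ) → ∑ xs (λ x → f x + g x) ≡ ∑ xs f + ∑ xs g
∑-+ []       f g = refl
∑-+ (x ∷ xs) f g = trans (cong (f x + g x +_) (∑-+ xs f g))
  (solve 4 (λ a b c d → a :+ b :+ (c :+ d) := a :+ c :+ (b :+ d)) refl
    (f x) (g x) (∑ xs f) (∑ xs g))
  where open +-*-Solver

∑-*ˡ : (xs : List A) (a : ℕ) (f : A → ℕ) → ∑ xs (λ x → a * f x) ≡ a * ∑ xs f
∑-*ˡ []       a f = sym (*-zeroʳ a)
∑-*ˡ (x ∷ xs) a f = trans (cong (a * f x +_) (∑-*ˡ xs a f)) (sym (*-distribˡ-+ a (f x) (∑ xs f)))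

∑-*ʳ : (xs : List A) (f : A → ℕ) (a : ℕ) → ∑ xs (λ x → f x * a) ≡ ∑ xs f * a
∑-*ʳ xs f a = trans (∑-cong xs (λ x → *-comm (f x) a)) (trans (∑-*ˡ xs a f) (*-comm a (∑ xs f)))

∑-const : (xs : List A) (a : ℕ) → ∑ xs (const a) ≡ length xs * a
∑-const []       a = refl
∑-const (x ∷ xs) a = cong (a +_) (∑-const xs a)

∑-swap : (xs : List A) (ys : List B) (f : A → B → ℕ) →
  ∑ xs (λ x → ∑ ys (f x)) ≡ ∑ ys (λ y → ∑ xs (λ x → f x y))
∑-swap []       ys f = sym (trans (∑-const ys 0) (*-zeroʳ (length ys)))
∑-swap (x ∷ xs) ys f = trans (cong (∑ ys (f x) +_) (∑-swap xs ys f))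
  (sym (∑-+ ys (f x) (λ y → ∑ xs (λ x′ → f x′ y))))

term≤∑ : (f : A → ℕ) {x : A} {xs : List A} → x ∈ xs → f x ≤ ∑ xs f
term≤∑ f (here refl)           = m≤m+n _ _
term≤∑ f {xs = y ∷ _} (there p) = ≤-trans (term≤∑ f p) (m≤n+m _ (f y))

module _ {P : A → Set} (P? : ∀ x → Dec (P x)) where

  1≤∑𝟙 : ∀ {x xs} → x ∈ xs → P x → 1 ≤ ∑ xs (𝟙 ∘ P?)
  1≤∑𝟙 {x} x∈xs px = subst (_≤ _) (𝟙-true (P? x) px) (term≤∑ (𝟙 ∘ P?) x∈xs)

  ∑𝟙≡0 : ∀ xs → (∀ x → x ∈ xs → ¬ P x) → ∑ xs (𝟙 ∘ P?) ≡ 0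
  ∑𝟙≡0 []       _  = refl
  ∑𝟙≡0 (x ∷ xs) ¬P = cong₂ _+_ (𝟙-false (P? x) (¬P x (here refl))) (∑𝟙≡0 xs (λ y → ¬P y ∘ there))

  ∑𝟙≤1 : ∀ {xs} → Unique xs → (∀ {x y} → P x → P y → x ≡ y) → ∑ xs (𝟙 ∘ P?) ≤ 1
  ∑𝟙≤1 []              _      = z≤n
  ∑𝟙≤1 {x ∷ xs} (x∉ ∷ u) P-prop with P? x
  ... | no _   = ∑𝟙≤1 u P-prop
  ... | yes px = s≤s (≤-reflexive (∑𝟙≡0 xs λ y y∈ py → All.lookup x∉ y∈ (P-prop px py)))

  ∑𝟙≤𝟙 : ∀ {xs} → Unique xs → (∀ {x y} → P x → P y → x ≡ y) →
    {Q : Set} (Q? : Dec Q) → (∀ x → x ∈ xs → P x → Q) → ∑ xs (𝟙 ∘ P?) ≤ 𝟙 Q?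
  ∑𝟙≤𝟙 u P-prop (yes _) _ = ∑𝟙≤1 u P-prop
  ∑𝟙≤𝟙 {xs} _ _ (no ¬q) P⇒Q = ≤-reflexive (∑𝟙≡0 xs λ x x∈ px → ¬q (P⇒Q x x∈ px))

  length-filter : ∀ xs → length (filter P? xs) ≡ ∑ xs (𝟙 ∘ P?)
  length-filter []       = refl
  length-filter (x ∷ xs) with does (P? x)
  ... | true  = cong suc (length-filter xs)
  ... | false = length-filter xs

length-filterᵇ : (p : A → Bool) (xs : List A) → length (filterᵇ p xs) ≡ ∑ xs (⟦_⟧ ∘ p)
length-filterᵇ p []       = refl
length-filterᵇ p (x ∷ xs) with p x
... | true  = cong suc (length-filterᵇ p xs)
... | false = length-filterᵇ p xs

-- Numerical inequalities

≤foldr-⊔ : ∀ {x xs} → x ∈ xs → x ≤ foldr _⊔_ 0 xs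
≤foldr-⊔ (here refl)             = m≤m⊔n _ _
≤foldr-⊔ {xs = y ∷ _} (there x∈) = ≤-trans (≤foldr-⊔ x∈) (m≤n⊔m y _)

-- The remainder of `n + k` modulo `suc k` is at most `k`, which cancels the `k` added for rounding
-- up.
n≤k*⌈n/k⌉ : ∀ n {k} → 1 ≤ k → n ≤ k * ⌈ n / k ⌉
n≤k*⌈n/k⌉ n {suc k} _ = +-cancelˡ-≤ k _ _ (begin
  k + n                                             ≡⟨ +-comm k n ⟩
  n + k                                             ≡⟨ m≡m%n+[m/n]*n (n + k) (suc k) ⟩
  (n + k) % suc k + (n + k) / suc k * suc k         ≤⟨ +-monoˡ-≤ _ (s≤s⁻¹ (m%n<n (n + k) (suc k))) ⟩
  k + (n + k) / suc k * suc k                       ≡⟨ cong (k +_) (*-comm ((n + k) / suc k) (suc k)) ⟩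
  k + suc k * ((n + k) / suc k)                     ∎)
  where open ≤-Reasoning

-- Applied with s full classes of size m, S vertices that are uncoloured or lie in these classes,
-- b other vertices, and D the maximum degree.
counting-contradiction : ∀ {k m s S b D} → S * (2 * k) ≤ S * (2 * s) + D * b →
  2 * k ≤ 2 * s + D → D ≤ k → S + b ≤ k * m → s * m < S → ⊥
counting-contradiction {k} {m} {s} {S} {b} {D} edges source D≤k total full
  -- From `s * m < S` and `S ≤ k * m` follows `s < k`; hence `k` becomes `suc s + t`, with
  -- `suc t > 0` colours beyond the full classes.
  with m≤n⇒∃[o]m+o≡n (*-cancelʳ-< m s k (≤-trans full (≤-trans (m≤m+n S b) total)))
... | t , refl = <-irrefl refl (begin-strict
  S * (2 * suc t)          ≤⟨ +-cancelˡ-≤ (S * (2 * s)) _ _ (subst (_≤ S * (2 * s) + D * b) split-S edges) ⟩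
  D * b                    ≤⟨ *-mono-≤ D≤2s (≤-trans (n≤1+n b) b<tm) ⟩
  2 * s * (suc t * m)      ≡⟨ solve 3 (λ s t m → con 2 :* s :* (t :* m) := con 2 :* t :* (s :* m)) refl s (suc t) m ⟩
  2 * suc t * (s * m)      <⟨ *-monoʳ-< (2 * suc t) full ⟩
  2 * suc t * S            ≡⟨ *-comm (2 * suc t) S ⟩
  S * (2 * suc t)          ∎)
  where
  open ≤-Reasoning
  open +-*-Solver
  split-S : S * (2 * (suc s + t)) ≡ S * (2 * s) + S * (2 * suc t)
  split-S = solve 3 (λ S s t → S :* (con 2 :* (con 1 :+ s :+ t)) := S :* (con 2 :* s) :+ S :* (con 2 :* (con 1 :+ t))) refl S s t
  D≤2s : D ≤ 2 * s
  -- Doubling `D ≤ k` gives `D + D ≤ 2 * k ≤ 2 * s + D`, and one `D` cancels.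
  D≤2s = +-cancelʳ-≤ D _ _ (≤-trans (subst (_≤ 2 * (suc s + t)) (cong (D +_) (+-identityʳ D)) (*-monoʳ-≤ 2 D≤k)) source)
  b<tm : b < suc t * m
  b<tm = +-cancelˡ-≤ (s * m) _ _ (begin
    s * m + suc b           ≡⟨ +-suc (s * m) b ⟩
    suc (s * m) + b         ≤⟨ +-monoˡ-≤ b full ⟩
    S + b                   ≤⟨ total ⟩
    (suc s + t) * m         ≡⟨ solve 3 (λ s t m → (con 1 :+ s :+ t) :* m := s :* m :+ (con 1 :+ t) :* m) refl s t m ⟩
    s * m + suc t * m       ∎)

-- Cycles

toℕ-≢ : ∀ {n} {i j : Fin n} → toℕ i < toℕ j → i ≢ j
toℕ-≢ i<j refl = <-irrefl refl i<j

inject₁<suc : ∀ {n} (i : Fin n) → toℕ (inject₁ i) < toℕ (Fin.suc i)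
inject₁<suc i = s≤s (≤-reflexive (Fin.toℕ-inject₁ i))

CycleIn-mono : ∀ {G} {P Q : Fin (n G) → Set} → (∀ {x} → P x → Q x) → CycleIn G P → CycleIn G Q
CycleIn-mono P⇒Q C = record { CycleIn C hiding (inP) ; inP = P⇒Q ∘ CycleIn.inP C }

-- The predecessor and the successor, wrapping round at the ends, differ because a cycle has at
-- least three positions. This keeps a vertex with at most one neighbour in a class off the cycles
-- of that class.
cycle-neighbours : ∀ {G P} (C : CycleIn G P) (i : Fin (3 + CycleIn.m C)) →
  ∃₂ λ j l → j ≢ i × l ≢ i × j ≢ l ×
    adj G (CycleIn.cyc C i) (CycleIn.cyc C j) ≡ true × adj G (CycleIn.cyc C i) (CycleIn.cyc C l) ≡ true
cycle-neighbours {G} C zero =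
  suc zero , fromℕ _ , (λ ()) , (λ ()) , (λ ()) , step zero , trans (adj-sym G _ _) close
  where open CycleIn C
cycle-neighbours {G} C (suc i) with view i
... | ‵fromℕ =
  zero , inject₁ i , (λ ()) , toℕ-≢ (inject₁<suc i) , (λ ()) ,
  close , trans (adj-sym G _ _) (step i)
  where open CycleIn C
... | ‵inject₁ j =
  suc (suc j) , inject₁ i , ≢-sym (toℕ-≢ (inject₁<suc (suc j))) , toℕ-≢ (inject₁<suc i) ,
  ≢-sym (toℕ-≢ (<-trans (inject₁<suc i) (inject₁<suc (suc j)))) ,
  step (suc j) , trans (adj-sym G _ _) (step i)
  where open CycleIn C

-- Partial colourings

degree≤Δ : (G : Graph) (v : Fin (n G)) → degree G v ≤ Δ G
degree≤Δ G v = ≤foldr-⊔ (∈-map⁺ (degree G) (∈-allFin v))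

module _ (G : Graph) where

  private
    V  = allFin (n G)
    _≟ᴹ_ = ≡-dec _≟_
    open DecMembership _≟ᴹ_ using () renaming (_∈?_ to _∈ᴹ?_)
    open DecMembership _≟_ using (_∈?_)

  e : Fin (n G) → Fin (n G) → ℕ
  e u v = ⟦ adj G u v ⟧

  -- The value nothing marks an uncoloured vertex.
  Colouring : Set
  Colouring = Fin (n G) → Maybe ℕ

  -- Indexed by `Maybe ℕ` so that `size-of c nothing` is the number of uncoloured vertices, the
  -- quantity to be brought down to zero.
  size-of : Colouring → Maybe ℕ → ℕ
  size-of c p = ∑ V (λ x → 𝟙 (c x ≟ᴹ p))

  degree-into : Colouring → Fin (n G) → ℕ → ℕ
  degree-into c x β = ∑ V (λ y → e x y * 𝟙 (c y ≟ᴹ just β))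

  ∑e≤Δ : ∀ x → ∑ V (e x) ≤ Δ G
  ∑e≤Δ x = ≤-trans (≤-reflexive (sym (length-filterᵇ (adj G x) V))) (degree≤Δ G x)

  -- Recolouring one vertex

  recolour : Colouring → Fin (n G) → ℕ → Colouring
  recolour c w β = updateAt c w (const (just β))

  module _ (c : Colouring) (w : Fin (n G)) (β : ℕ) where

    recolour-same : recolour c w β w ≡ just β
    recolour-same = updateAt-updates w c

    recolour-other : ∀ {x} → x ≢ w → recolour c w β x ≡ c x
    recolour-other x≢w = updateAt-minimal _ w c x≢w

    recolour⁻ : ∀ {x p} → p ≢ just β → recolour c w β x ≡ p → c x ≡ p
    recolour⁻ {x} p≢β eq with x Fin.≟ w
    ... | yes refl = contradiction (trans (sym eq) recolour-same) p≢β
    ... | no x≢w   = trans (sym (recolour-other x≢w)) eq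

    size-of-other : ∀ {p} → p ≢ just β → size-of (recolour c w β) p ≤ size-of c p
    size-of-other p≢β = ∑-mono V λ x _ → 𝟙-mono (_ ≟ᴹ _) (_ ≟ᴹ _) (recolour⁻ p≢β)

    -- The vertex lost is `w`, so even with its indicator added the new count stays within the old
    -- one.
    size-of-old : ∀ {p} → p ≢ just β → c w ≡ p → size-of (recolour c w β) p < size-of c p
    size-of-old {p} p≢β cw≡p = begin
      suc (size-of c′ p)                                   ≡⟨ +-comm 1 (size-of c′ p) ⟩
      size-of c′ p + 1                                     ≤⟨ +-monoʳ-≤ (size-of c′ p) (1≤∑𝟙 (Fin._≟ w) (∈-allFin w) refl) ⟩
      size-of c′ p + ∑ V (λ x → 𝟙 (x Fin.≟ w))             ≡⟨ ∑-+ V _ _ ⟨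
      ∑ V (λ x → 𝟙 (c′ x ≟ᴹ p) + 𝟙 (x Fin.≟ w))            ≤⟨ ∑-mono V (λ x _ → pointwise x) ⟩
      size-of c p                                          ∎
      where
      open ≤-Reasoning
      c′ = recolour c w β
      pointwise : ∀ x → 𝟙 (c′ x ≟ᴹ p) + 𝟙 (x Fin.≟ w) ≤ 𝟙 (c x ≟ᴹ p)
      pointwise x with x Fin.≟ w
      ... | yes refl rewrite 𝟙-false (c′ x ≟ᴹ p) (λ eq → p≢β (trans (sym eq) recolour-same))
                           | 𝟙-true (c x ≟ᴹ p) cw≡p = ≤-refl
      ... | no x≢w rewrite +-identityʳ (𝟙 (c′ x ≟ᴹ p)) =
        𝟙-mono (_ ≟ᴹ _) (_ ≟ᴹ _) (trans (sym (recolour-other x≢w)))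

    size-of-new : size-of (recolour c w β) (just β) ≤ suc (size-of c (just β))
    size-of-new = begin
      size-of c′ (just β)                                      ≤⟨ ∑-mono V (λ x _ → pointwise x) ⟩
      ∑ V (λ x → 𝟙 (c x ≟ᴹ just β) + 𝟙 (x Fin.≟ w))            ≡⟨ ∑-+ V _ _ ⟩
      size-of c (just β) + ∑ V (λ x → 𝟙 (x Fin.≟ w))           ≤⟨ +-monoʳ-≤ (size-of c (just β)) (∑𝟙≤1 (Fin._≟ w) (allFin⁺ (n G))
                                                                    (λ x≡w y≡w → trans x≡w (sym y≡w))) ⟩
      size-of c (just β) + 1                                   ≡⟨ +-comm (size-of c (just β)) 1 ⟩
      suc (size-of c (just β))                                 ∎
      where
      open ≤-Reasoning
      c′ = recolour c w β
      pointwise : ∀ x → 𝟙 (c′ x ≟ᴹ just β) ≤ 𝟙 (c x ≟ᴹ just β) + 𝟙 (x Fin.≟ w)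
      pointwise x with x Fin.≟ w
      ... | yes refl rewrite 𝟙-true (c′ x ≟ᴹ just β) recolour-same = m≤n+m 1 _
      ... | no x≢w = m≤n⇒m≤n+o 0 (𝟙-mono (_ ≟ᴹ _) (_ ≟ᴹ _) (trans (sym (recolour-other x≢w))))

    degree-into-other : ∀ {γ} x → γ ≢ β → degree-into (recolour c w β) x γ ≤ degree-into c x γ
    degree-into-other x γ≢β = ∑-mono V λ y _ → *-monoʳ-≤ (e x y)
      (𝟙-mono (_ ≟ᴹ _) (_ ≟ᴹ _) (recolour⁻ (γ≢β ∘ just-injective)))

  2≤degree-into : ∀ c {w y z β} → y ≢ z → adj G w y ≡ true → adj G w z ≡ true →
    c y ≡ just β → c z ≡ just β → 2 ≤ degree-into c w β
  2≤degree-into c {w} {y} {z} {β} y≢z wy wz cy cz = begin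
    1 + 1                                                    ≤⟨ +-mono-≤ (1≤∑𝟙 (Fin._≟ y) (∈-allFin y) refl) (1≤∑𝟙 (Fin._≟ z) (∈-allFin z) refl) ⟩
    ∑ V (λ x → 𝟙 (x Fin.≟ y)) + ∑ V (λ x → 𝟙 (x Fin.≟ z))    ≡⟨ ∑-+ V _ _ ⟨
    ∑ V (λ x → 𝟙 (x Fin.≟ y) + 𝟙 (x Fin.≟ z))                ≤⟨ ∑-mono V (λ x _ → pointwise x) ⟩
    degree-into c w β                                        ∎
    where
    open ≤-Reasoning
    pointwise : ∀ x → 𝟙 (x Fin.≟ y) + 𝟙 (x Fin.≟ z) ≤ e w x * 𝟙 (c x ≟ᴹ just β)
    pointwise x with x Fin.≟ y | x Fin.≟ z
    ... | yes refl | yes refl = contradiction refl y≢z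
    ... | yes refl | no _ rewrite wy | 𝟙-true (c x ≟ᴹ just β) cy = ≤-refl
    ... | no _ | yes refl rewrite wz | 𝟙-true (c x ≟ᴹ just β) cz = ≤-refl
    ... | no _ | no _ = z≤n

  -- A cycle of colour `β` avoiding `w` existed before the move; one through `w` would give `w` two
  -- distinct neighbours that already had colour `β`.
  recolour-acyclic : ∀ c w {β} → degree-into c w β ≤ 1 →
    (∀ γ → InducesAcyclic G (λ x → c x ≡ just γ)) →
    ∀ γ → InducesAcyclic G (λ x → recolour c w β x ≡ just γ)
  recolour-acyclic c w {β} few acyclic γ C with γ ≟ β
  ... | no γ≢β = acyclic γ (CycleIn-mono (recolour⁻ c w β (γ≢β ∘ just-injective)) C)
  ... | yes refl with Fin.any? (λ i → CycleIn.cyc C i Fin.≟ w)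
  ...   | no w∉C = acyclic β (record { CycleIn C hiding (inP) ; inP = λ i →
            trans (sym (recolour-other c w β (λ eq → w∉C (i , eq)))) (CycleIn.inP C i) })
  ...   | yes (i , ci≡w) with cycle-neighbours C i
  ...     | j , l , j≢i , l≢i , j≢l , ij , il =
            <-irrefl refl (≤-trans (2≤degree-into c (j≢l ∘ inj) (from-w ij) (from-w il) (old (avoid j≢i)) (old (avoid l≢i))) few)
    where
    open CycleIn C
    from-w : ∀ {x} → adj G (cyc i) x ≡ true → adj G w x ≡ true
    from-w {x} = subst (λ u → adj G u x ≡ true) ci≡w
    avoid : ∀ {j} → j ≢ i → cyc j ≢ w
    avoid j≢i eq = j≢i (inj (trans eq (sym ci≡w)))
    old : ∀ {j} → cyc j ≢ w → c (cyc j) ≡ just β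
    old {j} cj≢w = trans (sym (recolour-other c w β cj≢w)) (inP j)

  -- Chains of moves by vertices that are uncoloured or in reached classes

  palette : List ℕ → List (Maybe ℕ)
  palette A = nothing ∷ map just A

  just∉palette : ∀ {α A} → α ∉ A → just α ∉ palette A
  just∉palette α∉A (there p) with ∈-map⁻ just p
  ... | _ , q , refl = α∉A q

  palette-unique : ∀ {A} → Unique A → Unique (palette A)
  palette-unique u = ¬Any⇒All¬ _ (λ p → contradiction (proj₂ (proj₂ (∈-map⁻ just p))) λ ()) ∷
    map⁺ just-injective u

  module _ {k : ℕ} (La : ListAssignment G k) (m : ℕ) where

    record Good (c : Colouring) : Set where
      field
        inList  : ∀ {x β} → c x ≡ just β → β ∈ L La x
        bound   : ∀ β → size-of c (just β) ≤ m
        acyclic : ∀ β → InducesAcyclic G (λ x → c x ≡ just β)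

    -- Leaving a class only shrinks it, so only the class that `w` joins has to be checked.
    recolour-good : ∀ {c} w {β} → Good c → β ∈ L La w → degree-into c w β ≤ 1 →
      size-of c (just β) < m → Good (recolour c w β)
    recolour-good {c} w {β} good β∈L few room = record
      { inList  = inList′
      ; bound   = bound′
      ; acyclic = recolour-acyclic c w few acyclic
      }
      where
      open Good good
      inList′ : ∀ {x γ} → recolour c w β x ≡ just γ → γ ∈ L La x
      inList′ {x} eq with x Fin.≟ w
      ... | no x≢w = inList (trans (sym (recolour-other c w β x≢w)) eq)
      ... | yes refl with trans (sym (recolour-same c w β)) eq
      ...   | refl = β∈L
      bound′ : ∀ γ → size-of (recolour c w β) (just γ) ≤ m
      bound′ γ with γ ≟ β
      ... | no γ≢β   = ≤-trans (size-of-other c w β (γ≢β ∘ just-injective)) (bound γ)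
      ... | yes refl = ≤-trans (size-of-new c w β) room

    -- Each colour of the chain can receive a vertex that is uncoloured or has a later colour of the list;
    -- having at most one neighbour in the class it joins, that vertex closes no cycle.
    data Chain (c : Colouring) : List ℕ → Set where
      []   : Chain c []
      link : ∀ {β A} w → c w ∈ palette A → β ∈ L La w → degree-into c w β ≤ 1 →
             β ∉ A → Chain c A → Chain c (β ∷ A)

    chain-unique : ∀ {c A} → Chain c A → Unique A
    chain-unique []                     = []
    chain-unique (link _ _ _ _ β∉A ch) = ¬Any⇒All¬ _ β∉A ∷ chain-unique ch

    recolour-palette : ∀ {c w β u A} → c w ∉ palette A → c u ∈ palette A → recolour c w β u ∈ palette A
    recolour-palette {c} {w} {β} {A = A} cw∉A cu∈A =
      subst (_∈ palette A) (sym (recolour-other c w β λ { refl → cw∉A cu∈A })) cu∈A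

    -- Every vertex serving in the chain has its state in `palette A`, so none of them is `w`. The
    -- only class that grows is that of `β`, outside `A`, so degrees into the colours of `A` do not
    -- rise.
    recolour-chain : ∀ {c w β A} → β ∉ A → c w ∉ palette A → Chain c A → Chain (recolour c w β) A
    recolour-chain β∉A cw∉A [] = []
    recolour-chain {c} {w} {β} {α ∷ A} β∉αA cw∉αA (link u cu∈A α∈L few α∉A ch) =
      link u (recolour-palette {c} cw∉A cu∈A) α∈L
        (≤-trans (degree-into-other c w β u λ { refl → β∉αA (here refl) }) few)
        α∉A (recolour-chain (β∉αA ∘ there) cw∉A ch)
      where
      cw∉A : c w ∉ palette A
      cw∉A (here eq) = cw∉αA (here eq)
      cw∉A (there p) = cw∉αA (there (there p))

    Progress : Colouring → Set
    Progress c = ∃ λ c′ → Good c′ × size-of c′ nothing < size-of c nothing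

    -- The vertex w moving into β vacates the class α, and the rest of the chain then ends at α.
    shift : ∀ {c} A {β} → Good c → Chain c (β ∷ A) → size-of c (just β) < m → Progress c
    shift {c} A {β} good (link w (here cw≡nothing) β∈L few _ _) room =
      recolour c w β , recolour-good w good β∈L few room , size-of-old c w β (λ ()) cw≡nothing
    -- Here `w` comes from further down the chain, so `α` is bypassed.
    shift (α ∷ A) good (link w (there (there p)) β∈L few β∉A (link _ _ _ _ _ ch)) room =
      shift A good (link w (there p) β∈L few (β∉A ∘ there) ch) room
    shift {c} (α ∷ A) {β} good (link w (there (here cw≡α)) β∈L few β∉A (link u cu∈A α∈L few′ α∉A ch)) room =
      let c″ , good″ , less = shift A (recolour-good w good β∈L few room) chain′
                                -- The class `α` had at most `m` vertices and has just lost `w`, so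
                                -- it has room.
                                (≤-trans (size-of-old c w β (α≢β ∘ just-injective) cw≡α) (Good.bound good α))
      in c″ , good″ , ≤-trans less (size-of-other c w β λ ())
      where
      α≢β : α ≢ β
      α≢β refl = β∉A (here refl)
      cw∉A : c w ∉ palette A
      cw∉A = subst (_∉ palette A) (sym cw≡α) (just∉palette α∉A)
      chain′ : Chain (recolour c w β) (α ∷ A)
      chain′ = link u (recolour-palette {c} cw∉A cu∈A) α∈L
        (≤-trans (degree-into-other c w β u α≢β) few′) α∉A
        (recolour-chain (β∉A ∘ there) cw∉A ch)

    -- Double counting of the edges leaving the reached set

    module _ (c : Colouring) (A : List ℕ) where

      src out : Fin (n G) → ℕ
      src x = 𝟙 (c x ∈ᴹ? palette A)
      out x = 𝟙 (¬? (c x ∈ᴹ? palette A))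

      Extension : Fin (n G) → ℕ → Set
      Extension x β = β ∉ A × degree-into c x β ≤ 1

      extension? : ∀ x β → Dec (Extension x β)
      extension? x β = ¬? (β ∈? A) ×-dec (degree-into c x β ≤? 1)

      src+out : ∑ V src + ∑ V out ≡ n G
      src+out = trans (sym (∑-+ V src out)) (trans (∑-cong V (λ x → 𝟙-complement (c x ∈ᴹ? palette A)))
        (trans (∑-const V 1) (trans (*-identityʳ (length V)) (length-tabulate _))))

      full-∑ : ∀ {B} → All (λ α → m ≤ size-of c (just α)) B → length B * m ≤ ∑ (map just B) (size-of c)
      full-∑ []         = z≤n
      full-∑ (f ∷ full) = +-mono-≤ f (full-∑ full)

      -- The full classes of `A` are disjoint, and an uncoloured vertex makes the inequality strict.
      sources-many : Unique A → All (λ α → m ≤ size-of c (just α)) A → 1 ≤ size-of c nothing →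
        length A * m < ∑ V src
      sources-many u full uncoloured = begin
        1 + length A * m                                     ≤⟨ +-mono-≤ uncoloured (full-∑ full) ⟩
        ∑ (palette A) (size-of c)                            ≡⟨ ∑-swap (palette A) V _ ⟩
        ∑ V (λ x → ∑ (palette A) (λ p → 𝟙 (c x ≟ᴹ p)))       ≤⟨ ∑-mono V (λ x _ → ∑𝟙≤𝟙 (c x ≟ᴹ_) (palette-unique u)
                                                                  (λ p≡ q≡ → trans (sym p≡) q≡) (c x ∈ᴹ? palette A)
                                                                  (λ { _ p∈ refl → p∈ })) ⟩
        ∑ V src                                              ∎
        where open ≤-Reasoning

      -- Each colour of `A` matches at most one entry of the list, whose entries are distinct.
      ∑-list∩A : ∀ x → ∑ (L La x) (λ β → 𝟙 (β ∈? A)) ≤ length A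
      ∑-list∩A x = begin
        ∑ (L La x) (λ β → 𝟙 (β ∈? A))                        ≤⟨ ∑-mono (L La x) (λ β _ → member β) ⟩
        ∑ (L La x) (λ β → ∑ A (λ α → 𝟙 (β ≟ α)))             ≡⟨ ∑-swap (L La x) A _ ⟩
        ∑ A (λ α → ∑ (L La x) (λ β → 𝟙 (β ≟ α)))             ≤⟨ ∑-mono A (λ α _ → ∑𝟙≤1 (_≟ α) (distinct La x) (λ p q → trans p (sym q))) ⟩
        ∑ A (const 1)                                        ≡⟨ ∑-const A 1 ⟩
        length A * 1                                         ≡⟨ *-identityʳ (length A) ⟩
        length A                                             ∎
        where
        open ≤-Reasoning
        member : ∀ β → 𝟙 (β ∈? A) ≤ ∑ A (λ α → 𝟙 (β ≟ α))
        member β with β ∈? A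
        ... | yes β∈A = 1≤∑𝟙 (β ≟_) β∈A refl
        ... | no _    = z≤n

      -- Two edges for each of the at least k - length A blocked colours outside A.
      source-edges : ∀ x → (∀ β → β ∈ L La x → ¬ Extension x β) →
        2 * k ≤ 2 * length A + ∑ V (λ y → e x y * out y)
      source-edges x blocked = begin
        2 * k                                                ≡⟨ *-comm 2 k ⟩
        k * 2                                                ≡⟨ cong (_* 2) (size La x) ⟨
        length (L La x) * 2                                  ≡⟨ ∑-const (L La x) 2 ⟨
        ∑ (L La x) (const 2)                                 ≤⟨ ∑-mono (L La x) pointwise ⟩
        ∑ (L La x) (λ β → 2 * 𝟙 (β ∈? A) + into β)           ≡⟨ ∑-+ (L La x) _ into ⟩
        ∑ (L La x) (λ β → 2 * 𝟙 (β ∈? A)) + ∑ (L La x) into  ≤⟨ +-mono-≤ inside outside ⟩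
        2 * length A + ∑ V (λ y → e x y * out y)             ∎
        where
        open ≤-Reasoning
        -- The factor `out y` makes `into β` vanish for `β` in `A`, so the sum may run over the
        -- whole list.
        into : ℕ → ℕ
        into β = ∑ V (λ y → e x y * (𝟙 (c y ≟ᴹ just β) * out y))
        -- A colour in `A` is paid for by the first summand; any other is blocked, so its class
        -- contains at least two neighbours of `x`, all counted by `out`.
        pointwise : ∀ β → β ∈ L La x → 2 ≤ 2 * 𝟙 (β ∈? A) + into β
        pointwise β β∈L with β ∈? A
        ... | yes _  = m≤m+n 2 _
        ... | no β∉A = ≤-trans (≰⇒> (λ few → blocked β β∈L (β∉A , few)))
                         (∑-mono V λ y _ → *-monoʳ-≤ (e x y) (leave y))
          where
          leave : ∀ y → 𝟙 (c y ≟ᴹ just β) ≤ 𝟙 (c y ≟ᴹ just β) * out y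
          leave y with c y ≟ᴹ just β
          ... | no _   = z≤n
          ... | yes cy rewrite 𝟙-true (¬? (c y ∈ᴹ? palette A)) (subst (_∉ palette A) (sym cy) (just∉palette β∉A)) = ≤-refl
        inside : ∑ (L La x) (λ β → 2 * 𝟙 (β ∈? A)) ≤ 2 * length A
        inside = ≤-trans (≤-reflexive (∑-*ˡ (L La x) 2 _)) (*-monoʳ-≤ 2 (∑-list∩A x))
        -- Each neighbour `y` contributes at most once, since its colour occurs at most once in the
        -- list.
        outside : ∑ (L La x) into ≤ ∑ V (λ y → e x y * out y)
        outside = begin
          ∑ (L La x) into
            ≡⟨ ∑-swap (L La x) V _ ⟩
          ∑ V (λ y → ∑ (L La x) (λ β → e x y * (𝟙 (c y ≟ᴹ just β) * out y)))
            ≤⟨ ∑-mono V (λ y _ → begin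
                 ∑ (L La x) (λ β → e x y * (𝟙 (c y ≟ᴹ just β) * out y))  ≡⟨ ∑-*ˡ (L La x) (e x y) _ ⟩
                 e x y * ∑ (L La x) (λ β → 𝟙 (c y ≟ᴹ just β) * out y)    ≡⟨ cong (e x y *_) (∑-*ʳ (L La x) _ (out y)) ⟩
                 e x y * (∑ (L La x) (λ β → 𝟙 (c y ≟ᴹ just β)) * out y)  ≤⟨ *-monoʳ-≤ (e x y) (*-monoˡ-≤ (out y)
                   (∑𝟙≤1 (λ β → c y ≟ᴹ just β) (distinct La x) (λ p q → just-injective (trans (sym p) q)))) ⟩
                 e x y * (1 * out y)                                     ≡⟨ cong (e x y *_) (*-identityˡ (out y)) ⟩
                 e x y * out y                                           ∎) ⟩
          ∑ V (λ y → e x y * out y) ∎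

      e-sym : ∀ x y → e x y ≡ e y x
      e-sym x y = cong ⟦_⟧ (adj-sym G x y)

      -- Summing `source-edges` over the reached vertices counts edges to the other vertices, each
      -- of which meets at most `Δ G` edges.
      stuck-edges : (∀ x → c x ∈ palette A → ∀ β → β ∈ L La x → ¬ Extension x β) →
        ∑ V src * (2 * k) ≤ ∑ V src * (2 * length A) + Δ G * ∑ V out
      stuck-edges stuck = begin
        ∑ V src * (2 * k)
          ≡⟨ ∑-*ʳ V src (2 * k) ⟨
        ∑ V (λ x → src x * (2 * k))
          ≤⟨ ∑-mono V (λ x _ → pointwise x) ⟩
        ∑ V (λ x → src x * (2 * length A) + ∑ V (λ y → out y * e y x))
          ≡⟨ ∑-+ V _ _ ⟩
        ∑ V (λ x → src x * (2 * length A)) + ∑ V (λ x → ∑ V (λ y → out y * e y x))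
          ≡⟨ cong₂ _+_ (∑-*ʳ V src (2 * length A)) (∑-swap V V _) ⟩
        ∑ V src * (2 * length A) + ∑ V (λ y → ∑ V (λ x → out y * e y x))
          ≤⟨ +-monoʳ-≤ _ (∑-mono V (λ y _ → ≤-trans (≤-reflexive (∑-*ˡ V (out y) (e y))) (*-monoʳ-≤ (out y) (∑e≤Δ y)))) ⟩
        ∑ V src * (2 * length A) + ∑ V (λ y → out y * Δ G)
          ≡⟨ cong (∑ V src * (2 * length A) +_) (trans (∑-*ʳ V out (Δ G)) (*-comm (∑ V out) (Δ G))) ⟩
        ∑ V src * (2 * length A) + Δ G * ∑ V out ∎
        where
        open ≤-Reasoning
        pointwise : ∀ x → src x * (2 * k) ≤ src x * (2 * length A) + ∑ V (λ y → out y * e y x)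
        pointwise x = 𝟙*-≤ (c x ∈ᴹ? palette A) λ cx∈A → ≤-trans (source-edges x (stuck x cx∈A))
          (+-monoʳ-≤ (2 * length A) (≤-reflexive (∑-cong V λ y →
            trans (*-comm (e x y) (out y)) (cong (out y *_) (e-sym x y)))))

    -- The search for a class with room

    uncoloured-vertex : ∀ c → 1 ≤ size-of c nothing → ∃ λ v → c v ≡ nothing
    uncoloured-vertex c 1≤ with Fin.any? (λ v → c v ≟ᴹ nothing)
    ... | yes p = p
    ... | no ¬p = contradiction (subst (1 ≤_) (∑𝟙≡0 (λ v → c v ≟ᴹ nothing) V (λ v _ eq → ¬p (v , eq))) 1≤) λ ()

    module _ (Δ≤k : Δ G ≤ k) (n≤km : n G ≤ k * m) where

      -- Three outcomes: no reached vertex can move to a new colour, which the counting excludes; a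
      -- new class has room, and the chain is shifted; or the new class is full and prolongs the
      -- chain. The fuel measures how far the chain is from length `k`.
      progress : ∀ fuel {c} A → k ≤ fuel + length A → Good c → Chain c A →
        All (λ α → m ≤ size-of c (just α)) A → 1 ≤ size-of c nothing → Progress c
      progress fuel {c} A k≤ good ch full uncoloured
        with Fin.any? (λ x → (c x ∈ᴹ? palette A) ×-dec Any.any? (extension? c A x) (L La x))
      ... | no stuck =
        let v , cv≡nothing = uncoloured-vertex c uncoloured
            blocked = λ x cx∈A β β∈L ext → stuck (x , cx∈A , lose β∈L ext)
        in contradiction (sources-many c A (chain-unique ch) full uncoloured) (counting-contradiction
             {k} {m} {length A}
             (stuck-edges c A blocked)
             -- The bound by a single degree needs one reached vertex, and the uncoloured `v` is
             -- one.
             (≤-trans (source-edges c A v (blocked v (here cv≡nothing)))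
               (+-monoʳ-≤ (2 * length A) (≤-trans
                 (∑-mono V (λ y _ → m*𝟙≤m (e v y) (¬? (c y ∈ᴹ? palette A)))) (∑e≤Δ v))))
             Δ≤k
             (≤-trans (≤-reflexive (src+out c A)) n≤km))
      ... | yes (w , cw∈A , ext) with find ext
      ...   | β , β∈L , β∉A , few with m ≤? size-of c (just β) | fuel
      ...     | no β-room | _ = shift A good (link w cw∈A β∈L few β∉A ch) (≰⇒> β-room)
      ...     | yes β-full | suc f =
        progress f (β ∷ A) (≤-trans k≤ (≤-reflexive (sym (+-suc f (length A))))) good
          (link w cw∈A β∈L few β∉A ch) (β-full ∷ full) uncoloured
      -- Without fuel, `A` has at least `k` full classes; together with an uncoloured vertex they
      -- exceed the `k * m` bound on `n G`.
      ...     | yes _ | zero = contradiction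
        (≤-trans (sources-many c A (chain-unique ch) full uncoloured)
          (≤-trans (m≤m+n _ _) (≤-trans (≤-reflexive (src+out c A)) n≤km)))
        (≤⇒≯ (*-monoˡ-≤ m k≤))

      -- The fuel bounds the number of uncoloured vertices, and each round restarts the search from
      -- the empty chain.
      complete : ∀ fuel {c} → size-of c nothing ≤ fuel → Good c →
        ∃ λ c′ → Good c′ × size-of c′ nothing ≡ 0
      complete fuel {c} u≤fuel good with size-of c nothing in eq | fuel
      ... | zero  | _     = c , good , eq
      ... | suc u | suc f =
        let c′ , good′ , less = progress k [] (m≤m+n k 0) good [] [] (subst (1 ≤_) (sym eq) (s≤s z≤n))
        in complete f (s≤s⁻¹ (≤-trans less (≤-trans (≤-reflexive eq) u≤fuel))) good′

-- Total colourings and the four parts of the theorem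

Δ≤k⇒EquitablyListArborable : ∀ G {k} → 1 ≤ k → Δ G ≤ k → EquitablyListArborable G k
Δ≤k⇒EquitablyListArborable G {k} 1≤k Δ≤k La
  with complete G La ⌈ n G / k ⌉ Δ≤k (n≤k*⌈n/k⌉ (n G) 1≤k) _ {const nothing} ≤-refl blank
  where
  blank : Good G La ⌈ n G / k ⌉ (const nothing)
  blank = record
    { inList  = λ ()
    ; bound   = λ β → ≤-trans (≤-reflexive (∑𝟙≡0 (λ _ → ≡-dec _≟_ nothing (just β)) (allFin (n G)) (λ _ _ ()))) z≤n
    ; acyclic = λ β C → contradiction (CycleIn.inP C zero) λ ()
    }
... | c , good , none = col , (λ v → inList (coloured v)) , equitable ,
      (λ i C → acyclic i (CycleIn-mono (λ {x} eq → trans (coloured x) (cong just eq)) C))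
  where
  open Good good
  col : Fin (n G) → ℕ
  -- The default 0 is never taken, since `none` leaves no vertex uncoloured.
  col v = fromMaybe 0 (c v)
  coloured : ∀ v → c v ≡ just (col v)
  coloured v with c v in eq
  ... | just _  = refl
  ... | nothing = contradiction
    (subst (1 ≤_) none (1≤∑𝟙 (λ x → ≡-dec _≟_ (c x) nothing) (∈-allFin v) eq)) λ ()
  equitable : IsEquitable G k col
  equitable i = ≤-trans (≤-reflexive (length-filter (λ v → col v ≟ i) (allFin (n G))))
    (≤-trans (∑-mono (allFin (n G)) (λ v _ → 𝟙-mono (col v ≟ i) (≡-dec _≟_ (c v) (just i))
      (λ eq → trans (coloured v) (cong just eq)))) (bound i))

theorem2 : (r : ℕ) (G : Graph) → HasEdge G → Δ G ∸ 1 ≤ r →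
    ((k : ℕ) → r ≤ 7 → r + 1 ≤ k → EquitablyListArborable G k)
    × ((k : ℕ) → ((r ≤ 30 → 8 * r + 6 ≤ 7 * k) × (31 ≤ r → 7 * r ≤ 6 * k)) → EquitablyListArborable G k)
    × ((k : ℕ) → r ^ 3 ≤ ∣V∣ G → r + 2 ≤ k → EquitablyListArborable G k)
    × (ω≤ G r → 3 * (r + 1) * r ^ 8 ≤ ∣V∣ G → EquitablyListArborable G (r + 1))
theorem2 r G _ Δ∸1≤r =
    (λ k _ r<k → arborable k (≤-trans (≤-reflexive (+-comm 1 r)) r<k))
  , (λ k bounds → arborable k (r<k k bounds))
  , (λ k _ r+2≤k → arborable k (≤-trans (≤-trans (n≤1+n (suc r)) (≤-reflexive (+-comm 2 r))) r+2≤k))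
  , (λ _ _ → arborable (r + 1) (≤-reflexive (+-comm 1 r)))
  where
  arborable : ∀ k → r < k → EquitablyListArborable G k
  arborable k r<k = Δ≤k⇒EquitablyListArborable G (≤-trans (s≤s z≤n) r<k)
    (≤-trans (m≤n+m∸n (Δ G) 1) (≤-trans (s≤s Δ∸1≤r) r<k))
  -- The hypotheses are the two bounds of (ii) multiplied by 7 and by 6; `8 * r + 6` exceeds
  -- `7 * r`, and `7 * r` exceeds `6 * r` once `r` is positive.
  r<k : ∀ k → (r ≤ 30 → 8 * r + 6 ≤ 7 * k) × (31 ≤ r → 7 * r ≤ 6 * k) → r < k
  r<k k (small , large) with r ≤? 30
  ... | yes r≤30 = *-cancelˡ-< 7 r k (≤-trans (begin
    suc (7 * r)             ≤⟨ m≤m+n _ (r + 5) ⟩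
    suc (7 * r) + (r + 5)   ≡⟨ solve 1 (λ r → con 1 :+ con 7 :* r :+ (r :+ con 5) := con 8 :* r :+ con 6) refl r ⟩
    8 * r + 6               ∎) (small r≤30))
    where
    open ≤-Reasoning
    open +-*-Solver
  ... | no r≰30 = *-cancelˡ-< 6 r k (≤-trans (begin
    1 + 6 * r       ≤⟨ +-monoˡ-≤ (6 * r) (≤-trans (s≤s z≤n) (≰⇒> r≰30)) ⟩
    r + 6 * r       ∎) (large (≰⇒> r≰30)))
    where open ≤-Reasoning
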